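{- Let $\ell$ be an odd prime, let $t\ge2$ be an integer, and let $\alpha\in\mathbb{Z}_\ell^t\setminus(\ell\mathbb{Z}_\ell)^t$ be an admissible vector. If $t<\ell$, then $\mu_\ell(X_t,\alpha)=0$.
   Context: For $b\in\mathbb{Z}_\ell$ put $\binom{b}{n}=\frac{b(b-1)\cdots(b-n+1)}{n!}\in\mathbb{Z}_\ell$ and $(1+T)^b=\sum_{n\ge0}\binom{b}{n}T^n\in\mathbb{Z}_\ell[[T]]$. The bouquet $X_t$ is the multigraph with one vertex and $t$ undirected loops; a vector $\alpha=(\alpha_1,\dots,\alpha_t)\in\mathbb{Z}_\ell^t$ assigns the voltage $\alpha_j$ to the $j$-th loop. It is admissible if $\alpha\in\mathbb{Z}_\ell^t\setminus(\ell\mathbb{Z}_\ell)^t$. The characteristic series is $$f(T)=f_{X_t,\alpha}(T)=\sum_{j=1}^t\big(2-(1+T)^{\alpha_j}-(1+T)^{ -\alpha_j}\big)\in\mathbb{Z}_\ell[[T]].$$ For admissible $\alpha$ it is nonzero, and it has zero constant term. By Weierstrass preparation write $f(T)=\ell^{\mu}g(T)u(T)$ with $\mu\in\mathbb{Z}_{\ge0}$, $g$ a distinguished polynomial (monic, all non-leading coefficients divisible by $\ell$) and $u\in\mathbb{Z}_\ell[[T]]^\times$. Then $\mu_\ell(X_t,\alpha):=\mu$ and $\lambda_\ell(X_t,\alpha):=\deg g-1$. -}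

module Defs where

open import Level using (0ℓ; _⊔_)
open import Algebra.Bundles using (CommutativeRing; Semiring)
open import Data.Empty using (⊥-elim)
open import Data.Fin.Base using (Fin; toℕ)
open import Data.Integer.Base as ℤ using (ℤ; +_; -[1+_])
import Data.Integer.DivMod as DivMod
import Data.Integer.Properties as ℤₚ
open import Data.Integer.Divisibility.Signed as ℤ∣ using (divides)
open import Data.Integer.Tactic.RingSolver using (solve-∀)
open import Data.Nat.Base as ℕ using (ℕ; zero; suc; _!; NonZero)
import Data.Nat.Coprimality as Coprimality
import Data.Nat.Divisibility as ℕ∣
import Data.Nat.Properties as ℕₚ
open import Data.Nat.Primality using (Prime; prime⇒nonZero; prime⇒nonTrivial; prime⇒irreducible)
open import Data.Product.Base using (∃-syntax; _×_; _,_)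
open import Data.Sum.Base using (inj₁; inj₂)
open import Relation.Nullary using (¬_; yes; no)
open import Relation.Binary.PropositionalEquality
  using (_≡_; refl; sym; trans; cong; cong₂; subst; module ≡-Reasoning)

resp : ∀ {m a b} → a ≡ b → m ℤ∣.∣ a → m ℤ∣.∣ b
resp e (divides q eq) = divides q (trans (sym e) eq)

-- Abstract, so that the type checker does not normalise ring-solver output
-- whenever it unfolds the ring below.
abstract
  ≡⇒∣- : ∀ {m a b} → a ≡ b → m ℤ∣.∣ (a ℤ.- b)
  ≡⇒∣- {a = a} refl = divides (+ 0) (ℤₚ.+-inverseʳ a)

  cong-+ : ∀ {m} a b c d → m ℤ∣.∣ (a ℤ.- b) → m ℤ∣.∣ (c ℤ.- d) →
           m ℤ∣.∣ ((a ℤ.+ c) ℤ.- (b ℤ.+ d))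
  cong-+ a b c d p q = resp (lem a b c d) (ℤ∣.∣m∣n⇒∣m+n p q)
    where
    lem : ∀ a b c d → (a ℤ.- b) ℤ.+ (c ℤ.- d) ≡ (a ℤ.+ c) ℤ.- (b ℤ.+ d)
    lem = solve-∀

  cong-neg : ∀ {m} a b → m ℤ∣.∣ (a ℤ.- b) → m ℤ∣.∣ ((ℤ.- a) ℤ.- (ℤ.- b))
  cong-neg a b p = resp (lem a b) (ℤ∣.∣m⇒∣-m p)
    where
    lem : ∀ a b → ℤ.- (a ℤ.- b) ≡ (ℤ.- a) ℤ.- (ℤ.- b)
    lem = solve-∀

  cong-* : ∀ {m} a b c d → m ℤ∣.∣ (a ℤ.- b) → m ℤ∣.∣ (c ℤ.- d) →
           m ℤ∣.∣ ((a ℤ.* c) ℤ.- (b ℤ.* d))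
  cong-* a b c d p q =
    resp (lem a b c d) (ℤ∣.∣m∣n⇒∣m+n (ℤ∣.∣m⇒∣m*n c p) (ℤ∣.∣n⇒∣m*n b q))
    where
    lem : ∀ a b c d → (a ℤ.- b) ℤ.* c ℤ.+ b ℤ.* (c ℤ.- d) ≡ (a ℤ.* c) ℤ.- (b ℤ.* d)
    lem = solve-∀

  -‿sym : ∀ {m} a b → m ℤ∣.∣ (a ℤ.- b) → m ℤ∣.∣ (b ℤ.- a)
  -‿sym a b p = resp (lem a b) (ℤ∣.∣m⇒∣-m p)
    where
    lem : ∀ a b → ℤ.- (a ℤ.- b) ≡ b ℤ.- a
    lem = solve-∀

  -‿trans : ∀ {m} a b c → m ℤ∣.∣ (a ℤ.- b) → m ℤ∣.∣ (b ℤ.- c) → m ℤ∣.∣ (a ℤ.- c)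
  -‿trans a b c p q = resp (lem a b c) (ℤ∣.∣m∣n⇒∣m+n p q)
    where
    lem : ∀ a b c → (a ℤ.- b) ℤ.+ (b ℤ.- c) ≡ a ℤ.- c
    lem = solve-∀

-- The ring of ℓ-adic integers, as the inverse limit of the ℤ/ℓⁿ: an
-- element is a compatible family of integer representatives, and two
-- families are equal when they agree modulo ℓⁿ for every n.

record ℤ-adic (ℓ : ℕ) : Set where
  constructor mkℤ-adic
  field
    rep      : ℕ → ℤ
    coherent : ∀ n → + (ℓ ℕ.^ n) ℤ∣.∣ (rep (suc n) ℤ.- rep n)

open ℤ-adic public

module _ {ℓ : ℕ} where

  infix  4 _≈_
  infixl 6 _+_
  infixl 7 _*_
  infix  8 -_

  record _≈_ (x y : ℤ-adic ℓ) : Set where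
    constructor mk≈
    field at : ∀ n → + (ℓ ℕ.^ n) ℤ∣.∣ (rep x n ℤ.- rep y n)

  open _≈_ public

  ι : ℤ → ℤ-adic ℓ
  ι z = mkℤ-adic (λ _ → z) (λ _ → ≡⇒∣- {a = z} refl)

  _+_ : ℤ-adic ℓ → ℤ-adic ℓ → ℤ-adic ℓ
  x + y = mkℤ-adic (λ n → rep x n ℤ.+ rep y n)
    (λ n → cong-+ (rep x (suc n)) (rep x n) (rep y (suc n)) (rep y n)
             (coherent x n) (coherent y n))

  _*_ : ℤ-adic ℓ → ℤ-adic ℓ → ℤ-adic ℓ
  x * y = mkℤ-adic (λ n → rep x n ℤ.* rep y n)
    (λ n → cong-* (rep x (suc n)) (rep x n) (rep y (suc n)) (rep y n)
             (coherent x n) (coherent y n))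

  -_ : ℤ-adic ℓ → ℤ-adic ℓ
  - x = mkℤ-adic (λ n → ℤ.- rep x n)
    (λ n → cong-neg (rep x (suc n)) (rep x n) (coherent x n))

  pointwise : ∀ {x y} → (∀ n → rep x n ≡ rep y n) → x ≈ y
  pointwise e = mk≈ λ n → ≡⇒∣- (e n)

ℤ-adicRing : ℕ → CommutativeRing 0ℓ 0ℓ
ℤ-adicRing ℓ = record
  { Carrier = ℤ-adic ℓ
  ; _≈_ = _≈_
  ; _+_ = _+_
  ; _*_ = _*_
  ; -_ = -_
  ; 0# = ι (+ 0)
  ; 1# = ι (+ 1)
  ; isCommutativeRing = record
    { isRing = record
      { +-isAbelianGroup = record
        { isGroup = record
          { isMonoid = record
            { isSemigroup = record
              { isMagma = record
                { isEquivalence = record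
                  { refl  = pointwise λ _ → refl
                  ; sym   = λ {x} {y} p → mk≈ λ n → -‿sym (rep x n) (rep y n) (at p n)
                  ; trans = λ {x} {y} {z} p q → mk≈ λ n →
                      -‿trans (rep x n) (rep y n) (rep z n) (at p n) (at q n)
                  }
                ; ∙-cong = λ {x} {y} {u} {v} p q → mk≈ λ n →
                    cong-+ (rep x n) (rep y n) (rep u n) (rep v n) (at p n) (at q n)
                }
              ; assoc = λ x y z → pointwise λ n → ℤₚ.+-assoc (rep x n) (rep y n) (rep z n)
              }
            ; identity = (λ x → pointwise λ n → ℤₚ.+-identityˡ (rep x n))
                       , (λ x → pointwise λ n → ℤₚ.+-identityʳ (rep x n))
            }
          ; inverse = (λ x → pointwise λ n → ℤₚ.+-inverseˡ (rep x n))
                    , (λ x → pointwise λ n → ℤₚ.+-inverseʳ (rep x n))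
          ; ⁻¹-cong = λ {x} {y} p → mk≈ λ n → cong-neg (rep x n) (rep y n) (at p n)
          }
        ; comm = λ x y → pointwise λ n → ℤₚ.+-comm (rep x n) (rep y n)
        }
      ; *-cong = λ {x} {y} {u} {v} p q → mk≈ λ n →
          cong-* (rep x n) (rep y n) (rep u n) (rep v n) (at p n) (at q n)
      ; *-assoc = λ x y z → pointwise λ n → ℤₚ.*-assoc (rep x n) (rep y n) (rep z n)
      ; *-identity = (λ x → pointwise λ n → ℤₚ.*-identityˡ (rep x n))
                   , (λ x → pointwise λ n → ℤₚ.*-identityʳ (rep x n))
      ; distrib = (λ x y z → pointwise λ n → ℤₚ.*-distribˡ-+ (rep x n) (rep y n) (rep z n))
                , (λ x y z → pointwise λ n → ℤₚ.*-distribʳ-+ (rep x n) (rep y n) (rep z n))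
      }
    ; *-comm = λ x y → pointwise λ n → ℤₚ.*-comm (rep x n) (rep y n)
    }
  }

module PowerSeries {c e} (R : CommutativeRing c e) where

  private module R = CommutativeRing R
  open import Algebra.Definitions.RawMonoid R.+-rawMonoid using (sum)

  Series : Set c
  Series = ℕ → R.Carrier

  infix  4 _≋_
  infixl 6 _⊖_
  infixl 7 _⊛_

  _≋_ : Series → Series → Set e
  f ≋ g = ∀ n → f n R.≈ g n

  const : R.Carrier → Series
  const a zero    = a
  const a (suc _) = R.0#

  _⊖_ : Series → Series → Series
  (f ⊖ g) n = f n R.- g n

  _⊛_ : Series → Series → Series
  (f ⊛ g) n = sum {suc n} λ i → f (toℕ i) R.* g (n ℕ.∸ toℕ i)

  ⨁ : ∀ {t} → (Fin t → Series) → Series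
  ⨁ fs n = sum λ j → fs j n

  IsUnit : Series → Set (c ⊔ e)
  IsUnit u = ∃[ v ] u ⊛ v ≋ const R.1#

  module Weierstrass (ϖ : R.Carrier) where

    open import Algebra.Definitions.RawSemiring (Semiring.rawSemiring R.semiring) using (_^_; _∣_)

    -- Polynomials are regarded as power series with vanishing high coefficients.
    record IsDistinguished (d : ℕ) (g : Series) : Set (c ⊔ e) where
      field
        monic  : g d R.≈ R.1#
        lower  : ∀ i → i ℕ.< d → ϖ ∣ g i
        higher : ∀ i → d ℕ.< i → g i R.≈ R.0#

    record WeierstrassFactorization (f : Series) : Set (c ⊔ e) where
      field
        μ             : ℕ
        degree        : ℕ
        g             : Series
        u             : Series
        distinguished : IsDistinguished degree g
        unit          : IsUnit u
        factorization : f ≋ const (ϖ ^ μ) ⊛ g ⊛ u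

falling : ℤ → ℕ → ℤ
falling z zero    = + 1
falling z (suc n) = falling z n ℤ.* (z ℤ.- + n)

abstract
  falling-head : ∀ z n → falling (z ℤ.+ + 1) (suc n) ≡ (z ℤ.+ + 1) ℤ.* falling z n
  falling-head z zero = lem z
    where
    lem : ∀ z → + 1 ℤ.* ((z ℤ.+ + 1) ℤ.- + 0) ≡ (z ℤ.+ + 1) ℤ.* + 1
    lem = solve-∀
  falling-head z (suc n) =
    trans (cong (ℤ._* ((z ℤ.+ + 1) ℤ.- + suc n)) (falling-head z n))
          (lem z (falling z n) (+ n))
    where
    lem : ∀ z f k → ((z ℤ.+ + 1) ℤ.* f) ℤ.* ((z ℤ.+ + 1) ℤ.- (+ 1 ℤ.+ k))
                  ≡ (z ℤ.+ + 1) ℤ.* (f ℤ.* (z ℤ.- k))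
    lem = solve-∀

  falling-step : ∀ z n →
    falling (z ℤ.+ + 1) (suc n) ≡ falling z (suc n) ℤ.+ + suc n ℤ.* falling z n
  falling-step z n = trans (falling-head z n) (lem z (falling z n) (+ n))
    where
    lem : ∀ z f k → (z ℤ.+ + 1) ℤ.* f ≡ f ℤ.* (z ℤ.- k) ℤ.+ (+ 1 ℤ.+ k) ℤ.* f
    lem = solve-∀

  falling-0 : ∀ n → falling (+ 0) (suc n) ≡ + 0
  falling-0 zero    = refl
  falling-0 (suc n) = cong (ℤ._* (+ 0 ℤ.- + suc n)) (falling-0 n)

suc!∣ : ∀ n {w} → + (n !) ℤ∣.∣ w → + (suc n !) ℤ∣.∣ (+ suc n ℤ.* w)
suc!∣ n {w} d = subst (ℤ∣._∣ (+ suc n ℤ.* w)) (sym (ℤₚ.pos-* (suc n) (n !)))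
                  (ℤ∣.*-monoʳ-∣ (+ suc n) d)

!∣falling : ∀ n z → + (n !) ℤ∣.∣ falling z n
!∣falling zero    z = divides (+ 1) refl
!∣falling (suc n) = go
  where
  up : ∀ z → + (suc n !) ℤ∣.∣ falling z (suc n) →
       + (suc n !) ℤ∣.∣ falling (z ℤ.+ + 1) (suc n)
  up z d = resp (sym (falling-step z n)) (ℤ∣.∣m∣n⇒∣m+n d (suc!∣ n (!∣falling n z)))

  down : ∀ z → + (suc n !) ℤ∣.∣ falling (z ℤ.+ + 1) (suc n) →
         + (suc n !) ℤ∣.∣ falling z (suc n)
  down z d = ℤ∣.∣m+n∣n⇒∣m (resp (falling-step z n) d) (suc!∣ n (!∣falling n z))

  pos : ∀ m → + (suc n !) ℤ∣.∣ falling (+ m) (suc n)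
  pos zero    = resp (sym (falling-0 n)) (divides (+ 0) refl)
  pos (suc m) = subst (λ z → + (suc n !) ℤ∣.∣ falling z (suc n)) (ℤₚ.+-comm (+ m) (+ 1)) (up (+ m) (pos m))

  go : ∀ z → + (suc n !) ℤ∣.∣ falling z (suc n)
  go (+ m)          = pos m
  go -[1+ zero ]    = down -[1+ 0 ] (pos 0)
  go -[1+ suc m ]   = down -[1+ suc m ] (go -[1+ m ])

binomialℤ : ℤ → ℕ → ℤ
binomialℤ z n = (falling z n DivMod./ℕ (n !)) {{n ℕₚ.!≢0}}

abstract
  /ℕ-exact : ∀ z d .{{_ : NonZero d}} → + d ℤ∣.∣ z → z ≡ (z DivMod./ℕ d) ℤ.* + d
  /ℕ-exact z d d∣z = begin
    z                                             ≡⟨ DivMod.a≡a%ℕn+[a/ℕn]*n z d ⟩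
    + (z DivMod.%ℕ d) ℤ.+ (z DivMod./ℕ d) ℤ.* + d ≡⟨ cong (λ r → + r ℤ.+ (z DivMod./ℕ d) ℤ.* + d) r≡0 ⟩
    + 0 ℤ.+ (z DivMod./ℕ d) ℤ.* + d               ≡⟨ ℤₚ.+-identityˡ _ ⟩
    (z DivMod./ℕ d) ℤ.* + d                       ∎
    where
    open ≡-Reasoning
    d∣r : d ℕ∣.∣ z DivMod.%ℕ d
    d∣r = ℤ∣.∣⇒∣ᵤ (ℤ∣.∣m+n∣n⇒∣m {m = + (z DivMod.%ℕ d)} (resp (DivMod.a≡a%ℕn+[a/ℕn]*n z d) d∣z)
            (ℤ∣.∣n⇒∣m*n (z DivMod./ℕ d) ℤ∣.∣-refl))
    vanish : ∀ r → r ℕ.< d → d ℕ∣.∣ r → r ≡ 0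
    vanish zero    _   _ = refl
    vanish (suc r) r<d h = ⊥-elim (ℕ∣.>⇒∤ r<d h)
    r≡0 : z DivMod.%ℕ d ≡ 0
    r≡0 = vanish (z DivMod.%ℕ d) (DivMod.n%ℕd<d z d) d∣r

  binomialℤ-spec : ∀ z n → falling z n ≡ binomialℤ z n ℤ.* + (n !)
  binomialℤ-spec z n = /ℕ-exact (falling z n) (n !) {{n ℕₚ.!≢0}} (!∣falling n z)

abstract
  falling-cong : ∀ {m} a b n → m ℤ∣.∣ (a ℤ.- b) → m ℤ∣.∣ (falling a n ℤ.- falling b n)
  falling-cong a b zero    d = ≡⇒∣- {a = + 1} refl
  falling-cong a b (suc n) d =
    cong-* (falling a n) (falling b n) (a ℤ.- + n) (b ℤ.- + n) (falling-cong a b n d)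
      (cong-+ a b (ℤ.- + n) (ℤ.- + n) d (≡⇒∣- {a = ℤ.- + n} refl))

module _ {ℓ : ℕ} (ℓ-prime : Prime ℓ) where

  private
    instance
      ℓ≢0 : NonZero ℓ
      ℓ≢0 = prime⇒nonZero ℓ-prime

  abstract
    ∤⇒coprime-^ : ∀ {N} → ¬ ℓ ℕ∣.∣ N → ∀ m → ∀ d → ℓ ℕ.^ m ℕ∣.∣ N ℕ.* d → ℓ ℕ.^ m ℕ∣.∣ d
    ∤⇒coprime-^ ∤N zero    d _ = ℕ∣.1∣ d
    ∤⇒coprime-^ {N} ∤N (suc m) d h
      with Coprimality.coprime-divisor coprime (ℕ∣.∣-trans (ℕ∣.m∣m*n (ℓ ℕ.^ m)) h)
      where
      coprime : Coprimality.Coprime ℓ N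
      coprime (i∣ℓ , i∣N) with prime⇒irreducible ℓ-prime i∣ℓ
      ... | inj₁ i≡1 = i≡1
      ... | inj₂ i≡ℓ = ⊥-elim (∤N (subst (ℕ∣._∣ N) i≡ℓ i∣N))
    ... | ℕ∣.divides q refl =
      subst (ℓ ℕ.^ suc m ℕ∣.∣_) (ℕₚ.*-comm ℓ q) (ℕ∣.*-monoʳ-∣ ℓ
        (∤⇒coprime-^ ∤N m q (ℕ∣.*-cancelˡ-∣ ℓ (subst (ℓ ℕ.^ suc m ℕ∣.∣_) eq h))))
      where
      eq : N ℕ.* (q ℕ.* ℓ) ≡ ℓ ℕ.* (N ℕ.* q)
      eq = trans (sym (ℕₚ.*-assoc N q ℓ)) (ℕₚ.*-comm (N ℕ.* q) ℓ)

    cancelℕ : ∀ B N .{{_ : NonZero N}} → N ℕ.≤ B → ∀ k d →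
              ℓ ℕ.^ (k ℕ.+ B) ℕ∣.∣ N ℕ.* d → ℓ ℕ.^ k ℕ∣.∣ d
    cancelℕ zero    (suc _) () k d h
    cancelℕ (suc B) (suc N) N≤B k d h with ℓ ℕ∣.∣? suc N
    ... | no ∤N = ℕ∣.∣-trans
      (subst (ℓ ℕ.^ k ℕ∣.∣_) (sym (ℕₚ.^-distribˡ-+-* ℓ k (suc B))) (ℕ∣.m∣m*n _))
      (∤⇒coprime-^ ∤N (k ℕ.+ suc B) d h)
    ... | yes (ℕ∣.divides (suc q) e) =
      cancelℕ B (suc q) q<B k d (ℕ∣.*-cancelˡ-∣ ℓ
        (subst (ℕ∣._∣ ℓ ℕ.* (suc q ℕ.* d)) (cong (ℓ ℕ.^_) (ℕₚ.+-suc k B))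
          (subst (ℓ ℕ.^ (k ℕ.+ suc B) ℕ∣.∣_) eq h)))
      where
      q<B : suc q ℕ.≤ B
      q<B = ℕₚ.<⇒≤pred (ℕₚ.<-≤-trans
              (ℕₚ.m<m*n (suc q) ℓ (ℕ.nonTrivial⇒n>1 ℓ {{prime⇒nonTrivial ℓ-prime}}))
              (subst (ℕ._≤ suc B) e N≤B))
      eq : suc N ℕ.* d ≡ ℓ ℕ.* (suc q ℕ.* d)
      eq = trans (cong (ℕ._* d) (trans e (ℕₚ.*-comm (suc q) ℓ))) (ℕₚ.*-assoc ℓ (suc q) d)

    cancel-! : ∀ n k d → + (ℓ ℕ.^ (k ℕ.+ n !)) ℤ∣.∣ (d ℤ.* + (n !)) → + (ℓ ℕ.^ k) ℤ∣.∣ d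
    cancel-! n k d h = ℤ∣.∣ᵤ⇒∣ (cancelℕ (n !) (n !) {{n ℕₚ.!≢0}} ℕₚ.≤-refl k ℤ.∣ d ∣
      (subst (ℓ ℕ.^ (k ℕ.+ n !) ℕ∣.∣_)
        (trans (ℤₚ.abs-* d (+ (n !))) (ℕₚ.*-comm ℤ.∣ d ∣ (n !))) (ℤ∣.∣⇒∣ᵤ h)))

  -- Division by n! loses at most n! digits of ℓ-adic precision, so b is
  -- read n! places further along to obtain the n-th coefficient.
  binomial : ℤ-adic ℓ → ℕ → ℤ-adic ℓ
  binomial b n = mkℤ-adic (λ k → binomialℤ (rep b (k ℕ.+ n !)) n) λ k →
    let x = rep b (suc k ℕ.+ n !)
        y = rep b (k ℕ.+ n !)
    in cancel-! n k (binomialℤ x n ℤ.- binomialℤ y n)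
         (resp (trans (cong₂ ℤ._-_ (binomialℤ-spec x n) (binomialℤ-spec y n))
                      (lem (binomialℤ x n) (binomialℤ y n) (+ (n !))))
               (falling-cong x y n (coherent b (k ℕ.+ n !))))
    where
    lem : ∀ a b c → a ℤ.* c ℤ.- b ℤ.* c ≡ (a ℤ.- b) ℤ.* c
    lem = solve-∀

  fallingₗ : ℤ-adic ℓ → ℕ → ℤ-adic ℓ
  fallingₗ b zero    = ι (+ 1)
  fallingₗ b (suc n) = fallingₗ b n * (b + - ι (+ n))

  abstract
    rep-falling : ∀ b n k → rep (fallingₗ b n) k ≡ falling (rep b k) n
    rep-falling b zero    k = refl
    rep-falling b (suc n) k = cong (ℤ._* (rep b k ℤ.- + n)) (rep-falling b n k)

    shift : ∀ (b : ℤ-adic ℓ) k m → + (ℓ ℕ.^ k) ℤ∣.∣ (rep b (m ℕ.+ k) ℤ.- rep b k)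
    shift b k zero    = ≡⇒∣- {a = rep b k} refl
    shift b k (suc m) = -‿trans (rep b (suc m ℕ.+ k)) (rep b (m ℕ.+ k)) (rep b k)
      (ℤ∣.∣-trans (ℤ∣.∣ᵤ⇒∣ (subst (ℓ ℕ.^ k ℕ∣.∣_) (sym (ℕₚ.^-distribˡ-+-* ℓ m k)) (ℕ∣.n∣m*n (ℓ ℕ.^ m))))
        (coherent b (m ℕ.+ k)))
      (shift b k m)

  -- Since ℤ-adic ℓ has no n!-torsion, this characterises binomial b n.
  binomial-spec : ∀ b n → ι (+ (n !)) * binomial b n ≈ fallingₗ b n
  binomial-spec b n = mk≈ λ k →
    resp (cong₂ ℤ._-_
           (trans (binomialℤ-spec (rep b (k ℕ.+ n !)) n) (ℤₚ.*-comm _ (+ (n !))))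
           (sym (rep-falling b n k)))
      (falling-cong (rep b (k ℕ.+ n !)) (rep b k) n
        (subst (λ i → + (ℓ ℕ.^ k) ℤ∣.∣ (rep b i ℤ.- rep b k)) (ℕₚ.+-comm (n !) k) (shift b k (n !))))

-- A voltage assignment on the bouquet X_t is a function α on its t loops.

Admissible : ∀ {ℓ t} → (Fin t → ℤ-adic ℓ) → Set
Admissible {ℓ} α = ¬ (∀ j → ι (+ ℓ) ∣ α j)
  where
  open import Algebra.Definitions.RawMagma (CommutativeRing.*-rawMagma (ℤ-adicRing ℓ)) using (_∣_)

module _ {ℓ : ℕ} (ℓ-prime : Prime ℓ) where

  open PowerSeries (ℤ-adicRing ℓ)

  [1+T]^_ : ℤ-adic ℓ → Series
  [1+T]^ b = binomial ℓ-prime b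

  characteristicSeries : (t : ℕ) → (Fin t → ℤ-adic ℓ) → Series
  characteristicSeries t α =
    ⨁ λ j → const (ι (+ 2)) ⊖ [1+T]^ (α j) ⊖ [1+T]^ (- α j)

-- "μ_ℓ(X_t , α) = m": the characteristic series has a Weierstrass
-- factorization, and ℓ occurs to the power m in every such factorization.
-- A relation, because μ is not computable from an arbitrary power series.
μ_[X_,_]≡_ : ∀ {ℓ} → Prime ℓ → (t : ℕ) → (Fin t → ℤ-adic ℓ) → ℕ → Set
μ_[X_,_]≡_ {ℓ} ℓ-prime t α m =
  WeierstrassFactorization f × (∀ (w : WeierstrassFactorization f) → WeierstrassFactorization.μ w ≡ m)
  where
  open PowerSeries.Weierstrass (ℤ-adicRing ℓ) (ι (+ ℓ))
  f = characteristicSeries ℓ-prime t α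

{-# OPTIONS --safe #-}

-- Taking alternating sums of coefficients up to n turns (1+T)^b into
-- binom(b - 1, n).  For n = ℓ - 1 this is divisible by ℓ when b is a unit,
-- while for ℓ ∣ b the coefficients of 2 - (1+T)^b - (1+T)^(-b) below degree ℓ
-- all vanish mod ℓ.  Hence the alternating sum of the first ℓ coefficients of f
-- is ±2c mod ℓ, where c is the number of units among the α_j; as 1 ≤ c ≤ t < ℓ
-- and ℓ is odd, some coefficient of f is a unit, which forces μ = 0.
--
-- If f_d is the first unit coefficient, Weierstrass division of T^d by f gives a
-- unit q with q f distinguished of degree d.  Constructively, q is a fixed point
-- computed by an iteration that converges coefficientwise in the ℓ-adic topology.

module Submission where

open import Defs using (module PowerSeries)
open import Algebra.Bundles using (CommutativeRing; Semiring)
open import Data.Empty using (⊥-elim)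
open import Data.Fin.Base using (Fin; zero; suc; toℕ; fromℕ<; inject)
open import Data.Fin.Properties using (toℕ<n; toℕ-inject; toℕ-fromℕ<; ¬∀⟶∃¬-smallest)
open import Data.Integer.Base as ℤ using (ℤ; +_; -[1+_])
open import Data.Integer.Divisibility.Signed as ℤ∣ using (divides)
import Data.Integer.Properties as ℤₚ
open import Data.Integer.Tactic.RingSolver using (solve-∀)
open import Data.Nat.Base as ℕ using (ℕ; zero; suc; _≤_; _<_; _!; NonZero)
import Data.Nat.Coprimality as Coprimality
import Data.Nat.Divisibility as ℕ∣
open import Data.Nat.GCD using (module Bézout)
open import Data.Nat.Primality
  using (Prime; prime⇒nonZero; prime⇒nonTrivial; prime⇒irreducible; euclidsLemma; prime[2])
import Data.Nat.Properties as ℕₚ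
import Data.Nat.Tactic.RingSolver as ℕ-RingSolver
open import Data.Product.Base using (∃-syntax; _×_; _,_; proj₁; proj₂)
open import Data.Sum.Base as Sum using (_⊎_; inj₁; inj₂; [_,_]′)
open import Function.Base using (_∘_; id)
open import Relation.Binary.PropositionalEquality as ≡ using (_≡_)
open import Relation.Nullary using (¬_; Dec; yes; no)
open import Relation.Nullary.Decidable using (map′)

-- The Cauchy product of power series over a commutative ring.

module CauchyProduct {c e} (R : CommutativeRing c e) where

  open CommutativeRing R
  open PowerSeries R
  open import Algebra.Definitions.RawMonoid +-rawMonoid using (sum)
  open import Algebra.Properties.Monoid.Sum +-monoid using (sum-cong-≋; sum-replicate-zero)
  open import Algebra.Properties.CommutativeMonoid.Sum +-commutativeMonoid using (∑-distrib-+)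
  open import Algebra.Properties.Semiring.Sum semiring using (*-distribˡ-sum; *-distribʳ-sum)
  open import Algebra.Properties.CommutativeSemigroup +-commutativeSemigroup using (x∙yz≈y∙xz)
  open import Relation.Binary.Reasoning.Setoid setoid

  ⊛-cong : ∀ {f f′ g g′} → f ≋ f′ → g ≋ g′ → f ⊛ g ≋ f′ ⊛ g′
  ⊛-cong f≋ g≋ n = sum-cong-≋ {suc n} λ i → *-cong (f≋ (toℕ i)) (g≋ (n ℕ.∸ toℕ i))

  ⊛-distribˡ : ∀ f g h → f ⊛ (λ n → g n + h n) ≋ λ n → (f ⊛ g) n + (f ⊛ h) n
  ⊛-distribˡ f g h n = trans
    (sum-cong-≋ {suc n} λ i → distribˡ (f (toℕ i)) (g (n ℕ.∸ toℕ i)) (h (n ℕ.∸ toℕ i)))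
    (∑-distrib-+ {suc n} (λ i → f (toℕ i) * g (n ℕ.∸ toℕ i)) (λ i → f (toℕ i) * h (n ℕ.∸ toℕ i)))

  ⊛-distribʳ : ∀ f g h → (λ n → f n + g n) ⊛ h ≋ λ n → (f ⊛ h) n + (g ⊛ h) n
  ⊛-distribʳ f g h n = trans
    (sum-cong-≋ {suc n} λ i → distribʳ (h (n ℕ.∸ toℕ i)) (f (toℕ i)) (g (toℕ i)))
    (∑-distrib-+ {suc n} (λ i → f (toℕ i) * h (n ℕ.∸ toℕ i)) (λ i → g (toℕ i) * h (n ℕ.∸ toℕ i)))

  ⊛-scaleˡ : ∀ a f g → (λ n → a * f n) ⊛ g ≋ λ n → a * (f ⊛ g) n
  ⊛-scaleˡ a f g n = trans
    (sum-cong-≋ {suc n} λ i → *-assoc a (f (toℕ i)) (g (n ℕ.∸ toℕ i)))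
    (sym (*-distribˡ-sum {suc n} a λ i → f (toℕ i) * g (n ℕ.∸ toℕ i)))

  ⊛-scale-comm : ∀ a f g → (λ n → a * f n) ⊛ g ≋ f ⊛ (λ n → a * g n)
  ⊛-scale-comm a f g n = sum-cong-≋ {suc n} λ i →
    trans (*-congʳ (*-comm a (f (toℕ i)))) (*-assoc (f (toℕ i)) a (g (n ℕ.∸ toℕ i)))

  -- The product unfolds by splitting off the first coefficient of `f`. This is the mirror
  -- recursion, which splits off the first coefficient of `g`; comparing the two gives commutativity
  -- by induction.
  ⊛-last : ∀ f g n → (f ⊛ g) (suc n) ≈ f (suc n) * g 0 + (f ⊛ (g ∘ suc)) n
  ⊛-last f g zero    = x∙yz≈y∙xz _ _ _
  ⊛-last f g (suc n) = begin
    f 0 * g (suc (suc n)) + ((f ∘ suc) ⊛ g) (suc n)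
      ≈⟨ +-congˡ (⊛-last (f ∘ suc) g n) ⟩
    f 0 * g (suc (suc n)) + (f (suc (suc n)) * g 0 + ((f ∘ suc) ⊛ (g ∘ suc)) n)
      ≈⟨ x∙yz≈y∙xz _ _ _ ⟩
    f (suc (suc n)) * g 0 + (f ⊛ (g ∘ suc)) (suc n) ∎

  ⊛-comm : ∀ f g → f ⊛ g ≋ g ⊛ f
  ⊛-comm f g zero    = +-congʳ (*-comm (f 0) (g 0))
  ⊛-comm f g (suc n) = begin
    f 0 * g (suc n) + ((f ∘ suc) ⊛ g) n ≈⟨ +-cong (*-comm (f 0) _) (⊛-comm (f ∘ suc) g n) ⟩
    g (suc n) * f 0 + (g ⊛ (f ∘ suc)) n ≈⟨ ⊛-last g f n ⟨
    (g ⊛ f) (suc n)                     ∎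

  ⊛-assoc : ∀ f g h → (f ⊛ g) ⊛ h ≋ f ⊛ (g ⊛ h)
  ⊛-assoc f g h zero = +-congʳ (begin
    (f 0 * g 0 + 0#) * h 0 ≈⟨ *-congʳ (+-identityʳ _) ⟩
    f 0 * g 0 * h 0        ≈⟨ *-assoc _ _ _ ⟩
    f 0 * (g 0 * h 0)      ≈⟨ *-congˡ (+-identityʳ _) ⟨
    f 0 * (g 0 * h 0 + 0#) ∎)
  ⊛-assoc f g h (suc n) = begin
    -- The shift of `f ⊛ g` is by definition `λ i → f 0 * g (suc i) + (f′ ⊛ g) i`, so the induction
    -- passes from `f` to `f′`.
    (f 0 * g 0 + 0#) * h (suc n) + ((λ i → f 0 * g (suc i) + (f′ ⊛ g) i) ⊛ h) n
      ≈⟨ +-cong (*-congʳ (+-identityʳ _)) (⊛-distribʳ (λ i → f 0 * g (suc i)) (f′ ⊛ g) h n) ⟩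
    f 0 * g 0 * h (suc n) + (((λ i → f 0 * g (suc i)) ⊛ h) n + ((f′ ⊛ g) ⊛ h) n)
      ≈⟨ +-cong (*-assoc _ _ _) (+-cong (⊛-scaleˡ (f 0) (g ∘ suc) h n) (⊛-assoc f′ g h n)) ⟩
    f 0 * (g 0 * h (suc n)) + (f 0 * ((g ∘ suc) ⊛ h) n + (f′ ⊛ (g ⊛ h)) n)
      ≈⟨ +-assoc _ _ _ ⟨
    f 0 * (g 0 * h (suc n)) + f 0 * ((g ∘ suc) ⊛ h) n + (f′ ⊛ (g ⊛ h)) n
      ≈⟨ +-congʳ (distribˡ _ _ _) ⟨
    f 0 * (g ⊛ h) (suc n) + (f′ ⊛ (g ⊛ h)) n ∎
    where
    f′ = f ∘ suc

  T^_ : ℕ → Series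
  (T^ zero)  n       = const 1# n
  (T^ suc d) zero    = 0#
  (T^ suc d) (suc n) = (T^ d) n

  ⊛-T^ : ∀ f d k → (f ⊛ T^ d) (d ℕ.+ k) ≈ f k
  ⊛-T^ f (suc d) k = begin
    (f ⊛ T^ suc d) (suc (d ℕ.+ k))                ≈⟨ ⊛-last f (T^ suc d) (d ℕ.+ k) ⟩
    f (suc (d ℕ.+ k)) * 0# + (f ⊛ T^ d) (d ℕ.+ k) ≈⟨ +-cong (zeroʳ _) (⊛-T^ f d k) ⟩
    0# + f k                                      ≈⟨ +-identityˡ _ ⟩
    f k                                           ∎
  ⊛-T^ f zero zero = trans (+-identityʳ _) (*-identityʳ _)
  ⊛-T^ f zero (suc k) = begin
    (f ⊛ T^ 0) (suc k)                   ≈⟨ ⊛-last f (T^ 0) k ⟩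
    f (suc k) * 1# + (f ⊛ λ _ → 0#) k    ≈⟨ +-cong (*-identityʳ _) (sum-cong-≋ {suc k} λ i → zeroʳ (f (toℕ i))) ⟩
    f (suc k) + sum {suc k} (λ _ → 0#)   ≈⟨ +-congˡ (sum-replicate-zero (suc k)) ⟩
    f (suc k) + 0#                       ≈⟨ +-identityʳ _ ⟩
    f (suc k)                            ∎

  ⊛-identityʳ : ∀ f → f ⊛ const 1# ≋ f
  ⊛-identityʳ f = ⊛-T^ f 0

  ⊛-identityˡ : ∀ f → const 1# ⊛ f ≋ f
  ⊛-identityˡ f n = trans (⊛-comm (const 1#) f n) (⊛-identityʳ f n)

  T^-below : ∀ {d i} → i ℕ.< d → (T^ d) i ≈ 0#
  T^-below {suc d} {zero}  _           = refl
  T^-below {suc d} {suc i} (ℕ.s≤s i<d) = T^-below i<d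

  T^-leading : ∀ d → (T^ d) d ≈ 1#
  T^-leading zero    = refl
  T^-leading (suc d) = T^-leading d

-- Defs is opened only here because its arithmetic operators would clash with
-- those of the ring R above.
open import Defs

-- Congruences modulo powers of ℓ.

module Congruence (ℓ : ℕ) where

  private module R = CommutativeRing (ℤ-adicRing ℓ)
  open PowerSeries (ℤ-adicRing ℓ)
  open CauchyProduct (ℤ-adicRing ℓ)
  open import Algebra.Definitions.RawMonoid R.+-rawMonoid using (sum)
  open import Algebra.Definitions.RawMagma R.*-rawMagma using (_∣_; _,_)

  infix 4 _≈[_]_

  -- Coherence carries a congruence of the `n`-th representatives to all later ones, so one index is
  -- enough. The record wrapper lets `x`, `n` and `y` be inferred.
  record _≈[_]_ (x : ℤ-adic ℓ) (n : ℕ) (y : ℤ-adic ℓ) : Set where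
    constructor mod
    field divisible : + (ℓ ℕ.^ n) ℤ∣.∣ (rep x n ℤ.- rep y n)

  open _≈[_]_ public

  ≈⇒≈[] : ∀ {x y} → x ≈ y → ∀ {n} → x ≈[ n ] y
  ≈⇒≈[] p {n} = mod (at p n)

  ≈[]⇒≈ : ∀ {x y} → (∀ n → x ≈[ n ] y) → x ≈ y
  ≈[]⇒≈ p = mk≈ λ n → divisible (p n)

  ≈[]-refl : ∀ {n x} → x ≈[ n ] x
  ≈[]-refl = ≈⇒≈[] R.refl

  ≈[]-sym : ∀ {n x y} → x ≈[ n ] y → y ≈[ n ] x
  ≈[]-sym {n} {x} {y} (mod p) = mod (-‿sym (rep x n) (rep y n) p)

  ≈[]-trans : ∀ {n x y z} → x ≈[ n ] y → y ≈[ n ] z → x ≈[ n ] z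
  ≈[]-trans {n} {x} {y} {z} (mod p) (mod q) = mod (-‿trans (rep x n) (rep y n) (rep z n) p q)

  +-cong[] : ∀ {n x y u v} → x ≈[ n ] y → u ≈[ n ] v → x + u ≈[ n ] y + v
  +-cong[] {n} {x} {y} {u} {v} (mod p) (mod q) =
    mod (cong-+ (rep x n) (rep y n) (rep u n) (rep v n) p q)

  *-cong[] : ∀ {n x y u v} → x ≈[ n ] y → u ≈[ n ] v → x * u ≈[ n ] y * v
  *-cong[] {n} {x} {y} {u} {v} (mod p) (mod q) =
    mod (cong-* (rep x n) (rep y n) (rep u n) (rep v n) p q)

  -‿cong[] : ∀ {n x y} → x ≈[ n ] y → - x ≈[ n ] - y
  -‿cong[] {n} {x} {y} (mod p) = mod (cong-neg (rep x n) (rep y n) p)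

  sum-cong[] : ∀ {n t} {xs ys : Fin t → ℤ-adic ℓ} → (∀ j → xs j ≈[ n ] ys j) → sum xs ≈[ n ] sum ys
  sum-cong[] {t = zero}  p = ≈[]-refl
  sum-cong[] {t = suc t} p = +-cong[] (p zero) (sum-cong[] (p ∘ suc))

  *-zeroˡ[] : ∀ {n x} y → x ≈[ n ] R.0# → x * y ≈[ n ] R.0#
  *-zeroˡ[] y p = ≈[]-trans (*-cong[] p ≈[]-refl) (≈⇒≈[] (R.zeroˡ y))

  *-zeroʳ[] : ∀ {n y} x → y ≈[ n ] R.0# → x * y ≈[ n ] R.0#
  *-zeroʳ[] x p = ≈[]-trans (*-cong[] ≈[]-refl p) (≈⇒≈[] (R.zeroʳ x))

  sum-zero[] : ∀ {n t} {xs : Fin t → ℤ-adic ℓ} → (∀ j → xs j ≈[ n ] R.0#) → sum xs ≈[ n ] R.0#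
  sum-zero[] {t = zero}  p = ≈[]-refl
  sum-zero[] {t = suc t} p =
    ≈[]-trans (+-cong[] (p zero) (sum-zero[] (p ∘ suc))) (≈⇒≈[] (R.+-identityˡ R.0#))

  ⊛-cong[] : ∀ {m} f f′ g g′ n → (∀ i → i ≤ n → f i * g (n ℕ.∸ i) ≈[ m ] f′ i * g′ (n ℕ.∸ i)) →
             (f ⊛ g) n ≈[ m ] (f′ ⊛ g′) n
  ⊛-cong[] f f′ g g′ n p = sum-cong[] {t = suc n} λ i → p (toℕ i) (ℕₚ.≤-pred (toℕ<n i))

  ⊛-zero[] : ∀ {m} f g n → (∀ i → i ≤ n → f i * g (n ℕ.∸ i) ≈[ m ] R.0#) → (f ⊛ g) n ≈[ m ] R.0#
  ⊛-zero[] f g n p = sum-zero[] {t = suc n} λ i → p (toℕ i) (ℕₚ.≤-pred (toℕ<n i))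

  ^-∣ : ∀ {m n} → m ≤ n → ℓ ℕ.^ m ℕ∣.∣ ℓ ℕ.^ n
  ^-∣ {m} {n} m≤n = ≡.subst (ℓ ℕ.^ m ℕ∣.∣_)
    (≡.trans (≡.sym (ℕₚ.^-distribˡ-+-* ℓ m (n ℕ.∸ m))) (≡.cong (ℓ ℕ.^_) (ℕₚ.m+[n∸m]≡n m≤n)))
    (ℕ∣.m∣m*n _)

  rep-stable : ∀ x {m n} → m ≤ n → + (ℓ ℕ.^ m) ℤ∣.∣ (rep x n ℤ.- rep x m)
  rep-stable x m≤n = go (ℕₚ.≤⇒≤′ m≤n)
    where
    go : ∀ {m n} → m ℕ.≤′ n → + (ℓ ℕ.^ m) ℤ∣.∣ (rep x n ℤ.- rep x m)
    go {m} (ℕ.≤′-reflexive ≡.refl) = ≡⇒∣- {a = rep x m} ≡.refl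
    go {m} {suc n} (ℕ.≤′-step p) = -‿trans (rep x (suc n)) (rep x n) (rep x m)
      (ℤ∣.∣-trans (ℤ∣.∣ᵤ⇒∣ (^-∣ (ℕₚ.≤′⇒≤ p))) (coherent x n)) (go p)

  divisible-later : ∀ {m n x y} → m ≤ n → x ≈[ m ] y → + (ℓ ℕ.^ m) ℤ∣.∣ (rep x n ℤ.- rep y n)
  divisible-later {m} {n} {x} {y} m≤n (mod p) =
    -‿trans (rep x n) (rep x m) (rep y n) (rep-stable x m≤n)
      (-‿trans (rep x m) (rep y m) (rep y n) p (-‿sym (rep y n) (rep y m) (rep-stable y m≤n)))

  ≈[0] : ∀ {x y} → x ≈[ 0 ] y
  ≈[0] = mod (ℤ∣.∣ᵤ⇒∣ (ℕ∣.1∣ _))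

  -- The difference is (x - y) h, where x - y contributes ℓⁿ and `h` one further factor ℓ. This gain
  -- of a digit is what makes the iteration below converge.
  *-gain : ∀ {n x y h} → x ≈[ n ] y → h ≈[ 1 ] R.0# → x * h ≈[ suc n ] y * h
  *-gain {n} {x} {y} {h} p q = mod
    (resp (lem (rep x (suc n)) (rep y (suc n)) (rep h (suc n)))
      (ℤ∣.∣ᵤ⇒∣ (≡.subst₂ ℕ∣._∣_ (≡.sym (ℕₚ.^-distribˡ-+-* ℓ 1 n))
                  (≡.sym (ℤₚ.abs-* (rep h (suc n) ℤ.- + 0) (rep x (suc n) ℤ.- rep y (suc n))))
        (ℕ∣.*-pres-∣ (ℤ∣.∣⇒∣ᵤ (divisible-later (ℕ.s≤s ℕ.z≤n) q))
                     (ℤ∣.∣⇒∣ᵤ (divisible-later (ℕₚ.n≤1+n n) p))))))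
    where
    lem : ∀ x y h → (h ℤ.- + 0) ℤ.* (x ℤ.- y) ≡ x ℤ.* h ℤ.- y ℤ.* h
    lem = solve-∀

  ≈[1]0⇒∣rep : ∀ {x} → x ≈[ 1 ] R.0# → ∀ n → + ℓ ℤ∣.∣ rep x (suc n)
  ≈[1]0⇒∣rep {x} p n = ≡.subst₂ ℤ∣._∣_ (≡.cong +_ (ℕₚ.*-identityʳ ℓ)) (ℤₚ.+-identityʳ (rep x (suc n)))
    (divisible-later {y = R.0#} (ℕ.s≤s (ℕ.z≤n {n})) p)

  ∣rep⇒≈[1]0 : ∀ {x} n → + ℓ ℤ∣.∣ rep x (suc n) → x ≈[ 1 ] R.0#
  ∣rep⇒≈[1]0 {x} n ℓ∣ = mod (-‿trans (rep x 1) (rep x (suc n)) (+ 0)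
    (-‿sym (rep x (suc n)) (rep x 1) (rep-stable x (ℕ.s≤s (ℕ.z≤n {n}))))
    (≡.subst₂ ℤ∣._∣_ (≡.cong +_ (≡.sym (ℕₚ.*-identityʳ ℓ))) (≡.sym (ℤₚ.+-identityʳ (rep x (suc n)))) ℓ∣))

  -- Division by ℓ costs one digit, so the `n`-th representative of the quotient comes from
  -- representative `suc n` of `x`.
  ≈[1]0⇒∣ : .{{NonZero ℓ}} → ∀ {x} → x ≈[ 1 ] R.0# → ι (+ ℓ) ∣ x
  ≈[1]0⇒∣ {x} p = q , mk≈ λ n →
    resp (≡.cong (ℤ._- rep x n) (quotient-spec n)) (coherent x n)
    where
    quotient : ℕ → ℤ
    quotient n = ℤ∣._∣_.quotient (≈[1]0⇒∣rep p n)

    quotient-spec : ∀ n → rep x (suc n) ≡ quotient n ℤ.* + ℓ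
    quotient-spec n = ℤ∣._∣_.equality (≈[1]0⇒∣rep p n)

    lem : ∀ a b c → a ℤ.* c ℤ.- b ℤ.* c ≡ (a ℤ.- b) ℤ.* c
    lem = solve-∀

    q : ℤ-adic ℓ
    q = mkℤ-adic quotient λ n →
      ℤ∣.*-cancelʳ-∣ (+ ℓ) {+ (ℓ ℕ.^ n)}
        (≡.subst₂ ℤ∣._∣_
          (≡.trans (≡.cong +_ (ℕₚ.*-comm ℓ (ℓ ℕ.^ n))) (ℤₚ.pos-* (ℓ ℕ.^ n) ℓ))
          (≡.trans (≡.cong₂ ℤ._-_ (quotient-spec (suc n)) (quotient-spec n))
                   (lem (quotient (suc n)) (quotient n) (+ ℓ)))
          (coherent x (suc n)))

  -- Weierstrass division as an ℓ-adic fixed point.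

  module FixedPoint (d : ℕ) (h : Series) (small : ∀ {i} → i ≤ d → h i ≈[ 1 ] R.0#) where

    -- A fixed point p of this iteration makes p (T^d + h) have coefficient 1 in degree d and 0 in
    -- all higher degrees.
    approx : ℕ → Series
    approx zero    k = R.0#
    approx (suc N) k = const R.1# k + - (approx N ⊛ h) (d ℕ.+ k)

    -- An iteration step only uses the coefficients i ≤ d + k.  Those with i < k
    -- have a smaller index, and those with i ≥ k are multiplied by a multiple
    -- of ℓ, hence are needed to one digit less, at the cost of raising the
    -- index by at most d.  So weight d + 1 per digit makes the depth decrease.
    depth : ℕ → ℕ → ℕ
    depth n k = suc d ℕ.* n ℕ.+ k

    approx-step : ∀ N n k → depth n k ≤ N ℕ.+ d → approx (suc N) k ≈[ n ] approx N k
    approx-step N       zero    k _  = ≈[0]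
    -- With at least one digit the depth is at least d + 1, which exceeds the bound 0 + d.
    approx-step zero    (suc n) k le =
      ⊥-elim (ℕₚ.<⇒≱ (ℕₚ.n<1+n d)
        (ℕₚ.≤-trans (ℕₚ.m≤m*n (suc d) (suc n)) (ℕₚ.≤-trans (ℕₚ.m≤m+n _ k) le)))
    approx-step (suc N) (suc n) k le =
      +-cong[] ≈[]-refl (-‿cong[] (⊛-cong[] (approx (suc N)) (approx N) h h (d ℕ.+ k) term))
      where
      term : ∀ i → i ≤ d ℕ.+ k →
             approx (suc N) i * h (d ℕ.+ k ℕ.∸ i) ≈[ suc n ] approx N i * h (d ℕ.+ k ℕ.∸ i)
      term i i≤d+k with ℕₚ.<-≤-connex i k
      ... | inj₁ i<k = *-cong[] (approx-step N (suc n) i (ℕₚ.≤-pred (begin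
        suc (depth (suc n) i)            ≡⟨ ℕₚ.+-suc (suc d ℕ.* suc n) i ⟨
        suc d ℕ.* suc n ℕ.+ suc i        ≤⟨ ℕₚ.+-monoʳ-≤ (suc d ℕ.* suc n) i<k ⟩
        depth (suc n) k                  ≤⟨ le ⟩
        suc (N ℕ.+ d)                    ∎))) ≈[]-refl
        where open ℕₚ.≤-Reasoning
      ... | inj₂ k≤i = *-gain (approx-step N n i (ℕₚ.≤-pred (begin
        suc (suc d ℕ.* n ℕ.+ i)          ≤⟨ ℕ.s≤s (ℕₚ.+-monoʳ-≤ (suc d ℕ.* n) i≤d+k) ⟩
        suc (suc d ℕ.* n ℕ.+ (d ℕ.+ k))  ≡⟨ lem d n k ⟩
        depth (suc n) k                  ≤⟨ le ⟩
        suc (N ℕ.+ d)                    ∎)))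
        (small (ℕₚ.≤-trans (ℕₚ.∸-monoʳ-≤ (d ℕ.+ k) k≤i) (ℕₚ.≤-reflexive (ℕₚ.m+n∸n≡m d k))))
        where
        open ℕₚ.≤-Reasoning
        lem : ∀ d n k → suc (suc d ℕ.* n ℕ.+ (d ℕ.+ k)) ≡ suc d ℕ.* suc n ℕ.+ k
        lem = ℕ-RingSolver.solve-∀

    approx-stable : ∀ {N M} n k → N ≤ M → depth n k ≤ N → approx M k ≈[ n ] approx N k
    approx-stable n k N≤M le = go (ℕₚ.≤⇒≤′ N≤M)
      where
      go : ∀ {M} → _ ℕ.≤′ M → approx M k ≈[ n ] approx _ k
      go (ℕ.≤′-reflexive ≡.refl) = ≈[]-refl
      go (ℕ.≤′-step {M} p) = ≈[]-trans
        (approx-step M n k (ℕₚ.≤-trans le (ℕₚ.≤-trans (ℕₚ.≤′⇒≤ p) (ℕₚ.m≤m+n M d)))) (go p)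

    depth-mono : ∀ {n n′ k k′} → n ≤ n′ → k ≤ k′ → depth n k ≤ depth n′ k′
    depth-mono n≤ k≤ = ℕₚ.+-mono-≤ (ℕₚ.*-monoʳ-≤ (suc d) n≤) k≤

    -- A diagonal choice: from iterate `depth n k` on, coefficient `k` no longer changes modulo ℓⁿ.
    limit : Series
    limit k = mkℤ-adic (λ n → rep (approx (depth n k) k) n) λ n →
      let x = approx (depth (suc n) k) k
          y = approx (depth n k) k
      in -‿trans (rep x (suc n)) (rep x n) (rep y n) (coherent x n)
           (divisible (approx-stable n k (depth-mono (ℕₚ.n≤1+n n) (ℕₚ.≤-refl {k})) ℕₚ.≤-refl))

    limit≈approx : ∀ {N} n k → depth n k ≤ N → limit k ≈[ n ] approx N k
    -- `rep (limit k) n` is by definition `rep (approx (depth n k) k) n`, so the same divisibility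
    -- proof is only wrapped anew.
    limit≈approx n k le with mod p ← ≈[]-sym (approx-stable n k le ℕₚ.≤-refl) = mod p

    limit-fixed : ∀ k → limit k + (limit ⊛ h) (d ℕ.+ k) ≈ const R.1# k
    limit-fixed k = ≈[]⇒≈ λ n →
      -- This `N` is deep enough for every coefficient up to degree d + k. The lone `limit k` is
      -- compared with iterate `suc N`, whose defining formula then cancels the product.
      let N = depth n (d ℕ.+ k)
          N≥ = λ {i} (i≤ : i ≤ d ℕ.+ k) → depth-mono (ℕₚ.≤-refl {n}) i≤
      in ≈[]-trans
        (+-cong[]
          (limit≈approx n k (ℕₚ.≤-trans (N≥ (ℕₚ.m≤n+m k d)) (ℕₚ.n≤1+n N)))
          (⊛-cong[] limit (approx N) h h (d ℕ.+ k) λ i i≤ → *-cong[] (limit≈approx n i (N≥ i≤)) (≈[]-refl {x = h _})))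
        (≈⇒≈[] (cancel (const R.1# k) ((approx N ⊛ h) (d ℕ.+ k))))
      where
      cancel : ∀ x y → x + - y + y ≈ x
      cancel x y = R.trans (R.+-assoc x (- y) y)
        (R.trans (R.+-congˡ (R.-‿inverseˡ y)) (R.+-identityʳ x))

  -- Scaling by `c` gives c f = T^d + h with the coefficients of `h` divisible by ℓ up to degree d,
  -- so the fixed point p yields q = c p. The remainder stays implicit: it is accounted for by the
  -- coefficients of q f below degree d.
  weierstrassDivision : ∀ d f c → (∀ {i} → i < d → f i ≈[ 1 ] R.0#) → c * f d ≈[ 1 ] R.1# →
                        ∃[ q ] ∀ k → (q ⊛ f) (d ℕ.+ k) ≈ const R.1# k
  weierstrassDivision d f c low lead = (λ i → c * p i) , λ k → begin
    ((λ i → c * p i) ⊛ f) (d ℕ.+ k)          ≈⟨ ⊛-scale-comm c p f (d ℕ.+ k) ⟩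
    (p ⊛ (λ i → c * f i)) (d ℕ.+ k)          ≈⟨ ⊛-cong {p} (λ _ → R.refl) split (d ℕ.+ k) ⟩
    (p ⊛ (λ i → (T^ d) i + h i)) (d ℕ.+ k)   ≈⟨ ⊛-distribˡ p (T^ d) h (d ℕ.+ k) ⟩
    (p ⊛ T^ d) (d ℕ.+ k) + (p ⊛ h) (d ℕ.+ k) ≈⟨ R.+-congʳ (⊛-T^ p d k) ⟩
    p k + (p ⊛ h) (d ℕ.+ k)                  ≈⟨ limit-fixed k ⟩
    const R.1# k                             ∎
    where
    open import Relation.Binary.Reasoning.Setoid R.setoid
    h : Series
    h i = c * f i + - (T^ d) i

    split : ∀ i → c * f i ≈ (T^ d) i + h i
    split i = R.sym (xyx⁻¹≈y ((T^ d) i) (c * f i))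
      where
      xyx⁻¹≈y : ∀ x y → x + (y + - x) ≈ y
      xyx⁻¹≈y x y = R.trans (R.+-congˡ (R.+-comm y (- x)))
        (R.trans (R.sym (R.+-assoc x (- x) y))
          (R.trans (R.+-congʳ (R.-‿inverseʳ x)) (R.+-identityˡ y)))

    small : ∀ {i} → i ≤ d → h i ≈[ 1 ] R.0#
    small i≤d with ℕₚ.m≤n⇒m<n∨m≡n i≤d
    ... | inj₁ i<d = ≈[]-trans (+-cong[] (*-zeroʳ[] c (low i<d)) (-‿cong[] (≈⇒≈[] (T^-below i<d))))
                       (≈⇒≈[] (R.-‿inverseʳ R.0#))
    ... | inj₂ ≡.refl = ≈[]-trans (+-cong[] lead (-‿cong[] (≈⇒≈[] (T^-leading d))))
                       (≈⇒≈[] (R.-‿inverseʳ R.1#))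

    open FixedPoint d h small renaming (limit to p)

  -- Weierstrass preparation for a series with a unit coefficient.

  open PowerSeries.Weierstrass (ℤ-adicRing ℓ) (ι (+ ℓ))

  μ>0⇒ℓ∣ : ∀ {f m} (w : WeierstrassFactorization f) → WeierstrassFactorization.μ w ≡ suc m →
           ∀ n → f n ≈[ 1 ] R.0#
  μ>0⇒ℓ∣ {f} w ≡.refl n = ≈[]-trans (≈⇒≈[] (factorization n))
    (⊛-zero[] (ϖ^μ ⊛ g) u n λ i _ → *-zeroˡ[] (u (n ℕ.∸ i)) (⊛-zero[] ϖ^μ g i λ j _ → *-zeroˡ[] (g (i ℕ.∸ j)) (const≈0 j)))
    where
    open WeierstrassFactorization w
    open import Algebra.Definitions.RawSemiring (Semiring.rawSemiring R.semiring) using (_^_)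

    ℓ≈0 : ι (+ ℓ) ≈[ 1 ] R.0#
    ℓ≈0 = ∣rep⇒≈[1]0 0 ℤ∣.∣-refl

    ϖ^μ : Series
    ϖ^μ = const (ι (+ ℓ) ^ μ)

    const≈0 : ∀ i → ϖ^μ i ≈[ 1 ] R.0#
    const≈0 zero    = *-zeroˡ[] _ ℓ≈0
    const≈0 (suc i) = ≈[]-refl

  module _ {d f q} (low : ∀ {i} → i < d → f i ≈[ 1 ] R.0#)
           (q⊛f : ∀ k → (q ⊛ f) (d ℕ.+ k) ≈ const R.1# k) where

    quotient-monic : (q ⊛ f) d ≈ R.1#
    quotient-monic = ≡.subst (λ n → (q ⊛ f) n ≈ R.1#) (ℕₚ.+-identityʳ d) (q⊛f 0)

    quotient-distinguished : .{{NonZero ℓ}} → IsDistinguished d (q ⊛ f)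
    quotient-distinguished = record
      { monic  = quotient-monic
      ; lower  = λ i i<d → ≈[1]0⇒∣ (⊛-zero[] q f i λ j _ →
          *-zeroʳ[] (q j) (low (ℕₚ.≤-<-trans (ℕₚ.m∸n≤m i j) i<d)))
      ; higher = higher
      }
      where
      higher : ∀ i → d < i → (q ⊛ f) i ≈ R.0#
      -- Here i = d + (k + 1), a degree in which the division leaves 0.
      higher i d<i with k , eq ← ℕₚ.m≤n⇒∃[o]m+o≡n d<i =
        ≡.subst (λ n → (q ⊛ f) n ≈ R.0#) (≡.trans (ℕₚ.+-suc d k) eq) (q⊛f (suc k))

    -- Coefficient d of q f is 1, and modulo ℓ only its term q_0 f_d survives, since every other
    -- term contains some f_i with i < d.
    quotient-unit : f d * q 0 ≈[ 1 ] R.1#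
    quotient-unit = ≈[]-trans (≈⇒≈[] (R.trans (R.*-comm (f d) (q 0)) (R.sym (R.+-identityʳ _))))
      (≈[]-trans (≈[]-sym (+-cong[] ≈[]-refl (sum-zero[] λ i →
          *-zeroʳ[] (q (suc (toℕ i))) (low (below i)))))
        (≈⇒≈[] quotient-monic))
      where
      below : ∀ {n} (i : Fin n) → n ℕ.∸ suc (toℕ i) < n
      below {suc n} i = ℕ.s≤s (ℕₚ.m∸n≤m n (toℕ i))

  -- The leading factor `const R.1#` is the power of ℓ for μ = 0, in the shape that a factorization
  -- requires.
  inverse-quotient : ∀ {f q u} → u ⊛ q ≋ const R.1# → f ≋ const R.1# ⊛ (q ⊛ f) ⊛ u
  inverse-quotient {f} {q} {u} u⊛q n = R.sym (begin
    (const R.1# ⊛ (q ⊛ f) ⊛ u) n ≈⟨ ⊛-cong {g = u} (⊛-identityˡ (q ⊛ f)) (λ _ → R.refl) n ⟩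
    ((q ⊛ f) ⊛ u) n              ≈⟨ ⊛-comm (q ⊛ f) u n ⟩
    (u ⊛ (q ⊛ f)) n              ≈⟨ ⊛-assoc u q f n ⟨
    ((u ⊛ q) ⊛ f) n              ≈⟨ ⊛-cong {g = f} u⊛q (λ _ → R.refl) n ⟩
    (const R.1# ⊛ f) n           ≈⟨ ⊛-identityˡ f n ⟩
    f n                          ∎)
    where open import Relation.Binary.Reasoning.Setoid R.setoid

  weierstrassPreparation : .{{NonZero ℓ}} → ∀ d f c →
    (∀ {i} → i < d → f i ≈[ 1 ] R.0#) → c * f d ≈[ 1 ] R.1# → WeierstrassFactorization f
  weierstrassPreparation d f c low lead = record
    { μ             = 0
    ; degree        = d
    ; g             = q ⊛ f
    ; u             = u
    ; distinguished = quotient-distinguished {q = q} low q⊛f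
    ; unit          = q , u⊛q
    ; factorization = inverse-quotient {f} {q} {u} u⊛q
    }
    where
    division : ∃[ q ] ∀ k → (q ⊛ f) (d ℕ.+ k) ≈ const R.1# k
    division = weierstrassDivision d f c low lead

    q : Series
    q = proj₁ division

    q⊛f : ∀ k → (q ⊛ f) (d ℕ.+ k) ≈ const R.1# k
    q⊛f = proj₂ division

    division-of-q : ∃[ u ] u ⊛ q ≋ const R.1#
    -- Division with d = 0 leaves no room for a remainder, so the quotient is an inverse of `q`; by
    -- `quotient-unit`, `f d` inverts `q 0` modulo ℓ.
    division-of-q = weierstrassDivision 0 q (f d) (λ ()) (quotient-unit {q = q} low q⊛f)

    u : Series
    u = proj₁ division-of-q

    u⊛q : u ⊛ q ≋ const R.1#
    u⊛q = proj₂ division-of-q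

-- Identities for integer binomial coefficients.

pos-! : ∀ n → + (suc n !) ≡ + suc n ℤ.* + (n !)
pos-! n = ℤₚ.pos-* (suc n) (n !)

-- After multiplication by (n + 1)! this becomes `falling-step`.
binomialℤ-pascal : ∀ z n → binomialℤ (z ℤ.+ + 1) (suc n) ≡ binomialℤ z (suc n) ℤ.+ binomialℤ z n
binomialℤ-pascal z n = ℤₚ.*-cancelʳ-≡ _ _ (+ (suc n !)) {{suc n ℕₚ.!≢0}} (begin
  binomialℤ (z ℤ.+ + 1) (suc n) ℤ.* + (suc n !)
    ≡⟨ binomialℤ-spec (z ℤ.+ + 1) (suc n) ⟨
  falling (z ℤ.+ + 1) (suc n)
    ≡⟨ falling-step z n ⟩
  falling z (suc n) ℤ.+ + suc n ℤ.* falling z n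
    ≡⟨ ≡.cong₂ (λ a b → a ℤ.+ + suc n ℤ.* b) (binomialℤ-spec z (suc n)) (binomialℤ-spec z n) ⟩
  B ℤ.* + (suc n !) ℤ.+ + suc n ℤ.* (C ℤ.* + (n !))
    ≡⟨ ≡.cong (λ F → B ℤ.* F ℤ.+ + suc n ℤ.* (C ℤ.* + (n !))) (pos-! n) ⟩
  B ℤ.* (+ suc n ℤ.* + (n !)) ℤ.+ + suc n ℤ.* (C ℤ.* + (n !))
    ≡⟨ lem B C (+ suc n) (+ (n !)) ⟩
  (B ℤ.+ C) ℤ.* (+ suc n ℤ.* + (n !))
    ≡⟨ ≡.cong ((B ℤ.+ C) ℤ.*_) (pos-! n) ⟨
  (B ℤ.+ C) ℤ.* + (suc n !) ∎)
  where
  open ≡.≡-Reasoning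
  B = binomialℤ z (suc n)
  C = binomialℤ z n
  lem : ∀ B C s F → B ℤ.* (s ℤ.* F) ℤ.+ s ℤ.* (C ℤ.* F) ≡ (B ℤ.+ C) ℤ.* (s ℤ.* F)
  lem = solve-∀

-- After multiplication by n! this becomes `falling-head`. Read modulo ℓ, it serves both when ℓ
-- divides z + 1 and when ℓ = n + 1.
binomialℤ-absorb : ∀ z n → + suc n ℤ.* binomialℤ (z ℤ.+ + 1) (suc n) ≡ (z ℤ.+ + 1) ℤ.* binomialℤ z n
binomialℤ-absorb z n = ℤₚ.*-cancelʳ-≡ _ _ (+ (n !)) {{n ℕₚ.!≢0}} (begin
  + suc n ℤ.* B ℤ.* + (n !)      ≡⟨ lem (+ suc n) B (+ (n !)) ⟩
  B ℤ.* (+ suc n ℤ.* + (n !))    ≡⟨ ≡.cong (B ℤ.*_) (pos-! n) ⟨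
  B ℤ.* + (suc n !)              ≡⟨ binomialℤ-spec (z ℤ.+ + 1) (suc n) ⟨
  falling (z ℤ.+ + 1) (suc n)    ≡⟨ falling-head z n ⟩
  (z ℤ.+ + 1) ℤ.* falling z n    ≡⟨ ≡.cong ((z ℤ.+ + 1) ℤ.*_) (binomialℤ-spec z n) ⟩
  (z ℤ.+ + 1) ℤ.* (C ℤ.* + (n !)) ≡⟨ ℤₚ.*-assoc (z ℤ.+ + 1) C (+ (n !)) ⟨
  (z ℤ.+ + 1) ℤ.* C ℤ.* + (n !)  ∎)
  where
  open ≡.≡-Reasoning
  B = binomialℤ (z ℤ.+ + 1) (suc n)
  C = binomialℤ z n
  lem : ∀ s B F → s ℤ.* B ℤ.* F ≡ B ℤ.* (s ℤ.* F)
  lem = solve-∀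

pos-1+* : ∀ a b y x → 1 ℕ.+ y ℕ.* a ≡ x ℕ.* b → + 1 ℤ.+ + y ℤ.* + a ≡ + x ℤ.* + b
pos-1+* a b y x eq = ≡.trans (≡.cong (λ i → + 1 ℤ.+ i) (≡.sym (ℤₚ.pos-* y a)))
  (≡.trans (≡.cong +_ eq) (ℤₚ.pos-* x b))

-- Alternating sums of coefficients.

module AlternatingSum (ℓ : ℕ) where

  private module R = CommutativeRing (ℤ-adicRing ℓ)
  open PowerSeries (ℤ-adicRing ℓ)
  open Congruence ℓ
  open import Algebra.Definitions.RawMonoid R.+-rawMonoid using (sum)

  -- alt n s = Σ_{k ≤ n} (-1)^(n-k) s_k
  alt : ℕ → Series → ℤ-adic ℓ
  alt zero    s = s 0
  alt (suc n) s = s (suc n) + - alt n s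

  alt-zero[] : ∀ {m s} n → (∀ {k} → k ≤ n → s k ≈[ m ] R.0#) → alt n s ≈[ m ] R.0#
  alt-zero[] zero    p = p ℕ.z≤n
  alt-zero[] (suc n) p = ≈[]-trans
    (+-cong[] (p ℕₚ.≤-refl) (-‿cong[] (alt-zero[] n (λ k≤n → p (ℕₚ.m≤n⇒m≤1+n k≤n)))))
    (≈⇒≈[] (R.-‿inverseʳ R.0#))

  private
    interchange : ∀ a b c d → (a ℤ.- b) ℤ.- (c ℤ.- d) ≡ (a ℤ.- c) ℤ.- (b ℤ.- d)
    interchange = solve-∀

  alt-⊖ : ∀ n f g → alt n (f ⊖ g) ≈ alt n f + - alt n g
  alt-⊖ zero    f g = R.refl
  alt-⊖ (suc n) f g = R.trans (R.+-congˡ (R.-‿cong (alt-⊖ n f g)))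
    (pointwise λ m → interchange (rep (f (suc n)) m) (rep (g (suc n)) m)
                                 (rep (alt n f) m) (rep (alt n g) m))

  alt-⊖[] : ∀ {m x y} n f g → alt n f ≈[ m ] x → alt n g ≈[ m ] y → alt n (f ⊖ g) ≈[ m ] x + - y
  alt-⊖[] n f g p q = ≈[]-trans (≈⇒≈[] (alt-⊖ n f g)) (+-cong[] p (-‿cong[] q))

  alt-⨁ : ∀ {t} n (fs : Fin t → Series) → alt n (⨁ fs) ≈ sum (λ j → alt n (fs j))
  alt-⨁ zero    fs = R.refl
  alt-⨁ (suc n) fs = R.trans (R.+-congˡ (R.-‿cong (alt-⨁ n fs)))
    (sum-distrib-- (λ j → fs j (suc n)) (λ j → alt n (fs j)))
    where
    exchange : ∀ a b c d → (a ℤ.+ b) ℤ.- (c ℤ.+ d) ≡ (a ℤ.- c) ℤ.+ (b ℤ.- d)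
    exchange = solve-∀

    sum-distrib-- : ∀ {t} (xs ys : Fin t → ℤ-adic ℓ) → sum xs + - sum ys ≈ sum (λ j → xs j + - ys j)
    sum-distrib-- {zero}  xs ys = R.-‿inverseʳ R.0#
    sum-distrib-- {suc t} xs ys = R.trans
      (pointwise λ m → exchange (rep (xs zero) m) (rep (sum (xs ∘ suc)) m)
                                (rep (ys zero) m) (rep (sum (ys ∘ suc)) m))
      (R.+-congˡ (sum-distrib-- (xs ∘ suc) (ys ∘ suc)))

  -- Only the constant term contributes, with sign (-1)^n; absolute values avoid tracking that sign.
  ∣alt-const∣ : ∀ a n m → ℤ.∣ rep (alt n (const (ι a))) m ∣ ≡ ℤ.∣ a ∣
  ∣alt-const∣ a zero    m = ≡.refl
  ∣alt-const∣ a (suc n) m = ≡.trans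
    (≡.cong ℤ.∣_∣ (ℤₚ.+-identityˡ (ℤ.- r))) (≡.trans (ℤₚ.∣-i∣≡∣i∣ r) (∣alt-const∣ a n m))
    where r = rep (alt n (const (ι a))) m

  -- The witness `c` counts the indices at which `P` fails.
  indicator-sum : ∀ {p t n} {P : Fin t → Set p} → (∀ j → Dec (P j)) →
    ∀ τ (xs : Fin t → ℤ-adic ℓ) → (∀ j → P j → xs j ≈[ n ] R.0#) → (∀ j → ¬ P j → xs j ≈[ n ] τ) →
    ∃[ c ] c ≤ t × (c ≡ 0 → ∀ j → P j) × sum xs ≈[ n ] ι (+ c) * τ
  indicator-sum {t = zero} P? τ xs p ¬p =
    0 , ℕ.z≤n , (λ _ ()) , ≈⇒≈[] (R.sym (R.zeroˡ τ))
  indicator-sum {t = suc t} P? τ xs p ¬p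
    with P? zero | indicator-sum (P? ∘ suc) τ (xs ∘ suc) (p ∘ suc) (¬p ∘ suc)
  ... | yes p₀ | c , c≤t , c≡0⇒ , eq =
    c , ℕₚ.m≤n⇒m≤1+n c≤t , (λ { c≡0 zero → p₀ ; c≡0 (suc j) → c≡0⇒ c≡0 j }) ,
    ≈[]-trans (+-cong[] (p zero p₀) eq) (≈⇒≈[] (R.+-identityˡ _))
  ... | no ¬p₀ | c , c≤t , c≡0⇒ , eq =
    suc c , ℕ.s≤s c≤t , (λ ()) ,
    ≈[]-trans (+-cong[] (¬p zero ¬p₀) eq)
      (≈⇒≈[] (pointwise λ m → lem (+ c) (rep τ m)))
    where
    lem : ∀ c τ → τ ℤ.+ c ℤ.* τ ≡ (+ 1 ℤ.+ c) ℤ.* τ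
    lem = solve-∀

-- Inverses and binomial coefficients modulo ℓ.

module _ {ℓ : ℕ} (ℓ-prime : Prime ℓ) where

  private
    instance
      ℓ≢0 : NonZero ℓ
      ℓ≢0 = prime⇒nonZero ℓ-prime

    module R = CommutativeRing (ℤ-adicRing ℓ)
  open PowerSeries (ℤ-adicRing ℓ)
  open PowerSeries.Weierstrass (ℤ-adicRing ℓ) (ι (+ ℓ))
  open Congruence ℓ
  open AlternatingSum ℓ

  euclid : ∀ a b → + ℓ ℤ∣.∣ a ℤ.* b → + ℓ ℤ∣.∣ a ⊎ + ℓ ℤ∣.∣ b
  euclid a b h = Sum.map ℤ∣.∣ᵤ⇒∣ ℤ∣.∣ᵤ⇒∣
    (euclidsLemma ℤ.∣ a ∣ ℤ.∣ b ∣ ℓ-prime (≡.subst (ℓ ℕ∣.∣_) (ℤₚ.abs-* a b) (ℤ∣.∣⇒∣ᵤ h)))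

  ∣-∣-inverse-mod : ∀ z → ¬ + ℓ ℤ∣.∣ z → ∃[ c ] + ℓ ℤ∣.∣ c ℤ.* + ℤ.∣ z ∣ ℤ.- + 1
  ∣-∣-inverse-mod z ℓ∤z with Coprimality.coprime-Bézout coprime
    where
    coprime : Coprimality.Coprime ℓ ℤ.∣ z ∣
    coprime (i∣ℓ , i∣z) with prime⇒irreducible ℓ-prime i∣ℓ
    ... | inj₁ i≡1    = i≡1
    ... | inj₂ ≡.refl = ⊥-elim (ℓ∤z (ℤ∣.∣ᵤ⇒∣ i∣z))
  -- Over the naturals, Bézout has two forms. Here 1 + y |z| = x ℓ, so the inverse is -y; in the
  -- other form 1 + x ℓ = y |z|, and it is y.
  ... | Bézout.+- x y eq = ℤ.- + y , divides (ℤ.- + x) (begin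
    ℤ.- + y ℤ.* + ℤ.∣ z ∣ ℤ.- + 1      ≡⟨ lem (+ y) (+ ℤ.∣ z ∣) ⟩
    ℤ.- (+ 1 ℤ.+ + y ℤ.* + ℤ.∣ z ∣)    ≡⟨ ≡.cong ℤ.-_ (pos-1+* ℤ.∣ z ∣ ℓ y x eq) ⟩
    ℤ.- (+ x ℤ.* + ℓ)                  ≡⟨ ℤₚ.neg-distribˡ-* (+ x) (+ ℓ) ⟩
    ℤ.- + x ℤ.* + ℓ                    ∎)
    where
    open ≡.≡-Reasoning
    lem : ∀ y a → ℤ.- y ℤ.* a ℤ.- + 1 ≡ ℤ.- (+ 1 ℤ.+ y ℤ.* a)
    lem = solve-∀
  ... | Bézout.-+ x y eq = + y , divides (+ x) (begin
    + y ℤ.* + ℤ.∣ z ∣ ℤ.- + 1          ≡⟨ ≡.cong (ℤ._- + 1) (pos-1+* ℓ ℤ.∣ z ∣ x y eq) ⟨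
    + 1 ℤ.+ + x ℤ.* + ℓ ℤ.- + 1        ≡⟨ lem (+ x ℤ.* + ℓ) ⟩
    + x ℤ.* + ℓ                        ∎)
    where
    open ≡.≡-Reasoning
    lem : ∀ a → + 1 ℤ.+ a ℤ.- + 1 ≡ a
    lem = solve-∀

  inverse-mod : ∀ z → ¬ + ℓ ℤ∣.∣ z → ∃[ c ] + ℓ ℤ∣.∣ c ℤ.* z ℤ.- + 1
  inverse-mod (+ n)    ℓ∤z = ∣-∣-inverse-mod (+ n) ℓ∤z
  inverse-mod -[1+ n ] ℓ∤z with c , h ← ∣-∣-inverse-mod -[1+ n ] ℓ∤z =
    ℤ.- c , resp (≡.cong (ℤ._- + 1) (lem c (+ suc n))) h
    where
    lem : ∀ c z → c ℤ.* z ≡ ℤ.- c ℤ.* ℤ.- z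
    lem = solve-∀

  -- By absorption ℓ divides (k + 1) binom(z + 1, k + 1), and it cannot divide k + 1, which is
  -- positive and below ℓ.
  ∣binomialℤ : ∀ z k → + ℓ ℤ∣.∣ z ℤ.+ + 1 → suc k < ℓ → + ℓ ℤ∣.∣ binomialℤ (z ℤ.+ + 1) (suc k)
  ∣binomialℤ z k ℓ∣z+1 k<ℓ = [ (λ ℓ∣k → ⊥-elim (ℕ∣.>⇒∤ k<ℓ (ℤ∣.∣⇒∣ᵤ ℓ∣k))) , id ]′
    (euclid (+ suc k) (binomialℤ (z ℤ.+ + 1) (suc k))
      (resp (≡.sym (binomialℤ-absorb z k)) (ℤ∣.∣m⇒∣m*n (binomialℤ z k) ℓ∣z+1)))

  -- From (z + 1) binom(z, ℓ - 1) = ℓ binom(z + 1, ℓ).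
  ∣binomialℤ-pred : ∀ z n → suc n ≡ ℓ → ¬ + ℓ ℤ∣.∣ z ℤ.+ + 1 → + ℓ ℤ∣.∣ binomialℤ z n
  ∣binomialℤ-pred z n n+1≡ℓ ℓ∤z+1 = [ (λ h → ⊥-elim (ℓ∤z+1 h)) , id ]′
    (euclid (z ℤ.+ + 1) (binomialℤ z n)
      (resp (binomialℤ-absorb z n) (ℤ∣.∣m⇒∣m*n (binomialℤ (z ℤ.+ + 1) (suc n))
        (≡.subst (λ m → + ℓ ℤ∣.∣ + m) (≡.sym n+1≡ℓ) ℤ∣.∣-refl))))

  -- The two representatives agree modulo ℓ^(1 + k!), and cancelling k! still leaves a factor ℓ. The
  -- freedom in `M` lets one integer stand for `b` in several degrees at once.
  binomial-mod : ∀ b k M → 1 ℕ.+ k ! ≤ M → binomial ℓ-prime b k ≈[ 1 ] ι (binomialℤ (rep b M) k)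
  binomial-mod b k M le = mod (cancel-! ℓ-prime k 1 (binomialℤ x k ℤ.- binomialℤ y k)
    (resp (≡.trans (≡.cong₂ ℤ._-_ (binomialℤ-spec x k) (binomialℤ-spec y k))
                   (lem (binomialℤ x k) (binomialℤ y k) (+ (k !))))
          (falling-cong x y k (-‿sym y x (rep-stable b le)))))
    where
    x = rep b (1 ℕ.+ k !)
    y = rep b M
    lem : ∀ a b c → a ℤ.* c ℤ.- b ℤ.* c ≡ (a ℤ.- b) ℤ.* c
    lem = solve-∀

  -- Taking alternating sums is division by 1 + T, which lowers the exponent from z + 1 to z; on
  -- coefficients each step is Pascal's rule.
  alt-binomial : ∀ b z n → (∀ {k} → k ≤ n → binomial ℓ-prime b k ≈[ 1 ] ι (binomialℤ (z ℤ.+ + 1) k)) →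
                 alt n (binomial ℓ-prime b) ≈[ 1 ] ι (binomialℤ z n)
  alt-binomial b z zero    p = p ℕ.z≤n
  alt-binomial b z (suc n) p = ≈[]-trans
    (+-cong[] (p ℕₚ.≤-refl) (-‿cong[] (alt-binomial b z n (p ∘ ℕₚ.m≤n⇒m≤1+n))))
    (≈⇒≈[] (pointwise λ _ → ≡.trans (≡.cong (ℤ._- binomialℤ z n) (binomialℤ-pascal z n))
                               (lem (binomialℤ z (suc n)) (binomialℤ z n))))
    where
    lem : ∀ B C → (B ℤ.+ C) ℤ.- C ≡ B
    lem = solve-∀

  ≈[1]0? : ∀ x → Dec (x ≈[ 1 ] R.0#)
  ≈[1]0? x = map′ (∣rep⇒≈[1]0 0) (λ p → ≈[1]0⇒∣rep p 0) (+ ℓ ℤ∣.∣? rep x 1)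

  pred-suc : ∀ z → (z ℤ.- + 1) ℤ.+ + 1 ≡ z
  pred-suc = solve-∀

  binomial≈0 : ∀ {b k} → b ≈[ 1 ] R.0# → suc k < ℓ → binomial ℓ-prime b (suc k) ≈[ 1 ] R.0#
  binomial≈0 {b} {k} b≈0 k<ℓ = ≈[]-trans (binomial-mod b (suc k) (1 ℕ.+ suc k !) ℕₚ.≤-refl)
    (∣rep⇒≈[1]0 0 (≡.subst (λ y → + ℓ ℤ∣.∣ binomialℤ y (suc k)) (pred-suc x)
      (∣binomialℤ (x ℤ.- + 1) k (resp (≡.sym (pred-suc x)) (≈[1]0⇒∣rep b≈0 (suc k !))) k<ℓ)))
    where x = rep b (1 ℕ.+ suc k !)

  alt-binomial≈0 : ∀ {b n} → suc n ≡ ℓ → ¬ b ≈[ 1 ] R.0# → alt n (binomial ℓ-prime b) ≈[ 1 ] R.0#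
  alt-binomial≈0 {b} {n} n+1≡ℓ b≉0 = ≈[]-trans
    (alt-binomial b (x ℤ.- + 1) n λ {k} k≤n →
      ≡.subst (λ y → binomial ℓ-prime b k ≈[ 1 ] ι (binomialℤ y k)) (≡.sym (pred-suc x))
        (binomial-mod b k (1 ℕ.+ n !) (ℕ.s≤s (!-mono k≤n))))
    (∣rep⇒≈[1]0 0 (∣binomialℤ-pred (x ℤ.- + 1) n n+1≡ℓ λ h →
      b≉0 (∣rep⇒≈[1]0 (n !) (resp (pred-suc x) h))))
    where
    -- The index 1 + n! is at least 1 + k! for every k ≤ n, so this single integer works in all
    -- degrees of the sum.
    x = rep b (1 ℕ.+ n !)
    !-mono : ∀ {k} → k ≤ n → k ! ≤ n !
    !-mono k≤n = ℕ∣.∣⇒≤ {{n ℕₚ.!≢0}} (ℕ∣.m≤n⇒m!∣n! k≤n)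

  -- The contribution of a single loop.

  loopSeries : ℤ-adic ℓ → Series
  loopSeries b = const (ι (+ 2)) ⊖ binomial ℓ-prime b ⊖ binomial ℓ-prime (- b)

  0--0--0 : R.0# + - R.0# + - R.0# ≈ R.0#
  0--0--0 = pointwise λ _ → ≡.refl

  alt-loop-nonunit : ∀ {b n} → suc n ≡ ℓ → b ≈[ 1 ] R.0# → alt n (loopSeries b) ≈[ 1 ] R.0#
  alt-loop-nonunit {b} {n} ≡.refl b≈0 = alt-zero[] n (λ {k} → coefficient k)
    where
    -b≈0 : - b ≈[ 1 ] R.0#
    -b≈0 = ≈[]-trans (-‿cong[] b≈0) (≈⇒≈[] (pointwise λ _ → ≡.refl))

    coefficient : ∀ k → k ≤ n → loopSeries b k ≈[ 1 ] R.0#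
    -- In degree 0 the coefficient is 2 - 1 - 1.
    coefficient zero    _   = ≈⇒≈[] (pointwise λ _ → ≡.refl)
    coefficient (suc k) k<n = ≈[]-trans
      (+-cong[] (+-cong[] ≈[]-refl (-‿cong[] (binomial≈0 {b} b≈0 (ℕ.s≤s k<n))))
                (-‿cong[] (binomial≈0 { - b} -b≈0 (ℕ.s≤s k<n))))
      (≈⇒≈[] 0--0--0)

  -- Neither b nor -b is divisible by ℓ, so both binomial series drop out of the alternating sum and
  -- only the constant 2 is left.
  alt-loop-unit : ∀ {b n} → suc n ≡ ℓ → ¬ b ≈[ 1 ] R.0# →
                  alt n (loopSeries b) ≈[ 1 ] alt n (const (ι (+ 2)))
  alt-loop-unit {b} {n} n+1≡ℓ b≉0 = ≈[]-trans
    (alt-⊖[] n (two ⊖ binomial ℓ-prime b) (binomial ℓ-prime (- b))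
      (alt-⊖[] n two (binomial ℓ-prime b) ≈[]-refl (alt-binomial≈0 {b} n+1≡ℓ b≉0))
      (alt-binomial≈0 { - b} n+1≡ℓ -b≉0))
    (≈⇒≈[] (pointwise λ m → lem (rep (alt n two) m)))
    where
    two : Series
    two = const (ι (+ 2))

    -b≉0 : ¬ - b ≈[ 1 ] R.0#
    -b≉0 -b≈0 = b≉0 (≈[]-trans
      (≈[]-trans (≈⇒≈[] (pointwise λ m → ≡.sym (ℤₚ.neg-involutive (rep b m)))) (-‿cong[] -b≈0))
      (≈⇒≈[] (pointwise λ _ → ≡.refl)))

    lem : ∀ a → a ℤ.+ + 0 ℤ.+ + 0 ≡ a
    lem = solve-∀

  -- A unit coefficient of the characteristic series.

  ℓ∤2 : ¬ 2 ℕ∣.∣ ℓ → ¬ ℓ ℕ∣.∣ 2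
  ℓ∤2 odd ℓ∣2 with prime⇒irreducible prime[2] ℓ∣2
  ... | inj₁ ≡.refl = ℕₚ.<-irrefl ≡.refl (ℕ.nonTrivial⇒n>1 1 {{prime⇒nonTrivial ℓ-prime}})
  ... | inj₂ ≡.refl = odd ℕ∣.∣-refl

  -- Up to sign the product is 2c; the odd prime ℓ does not divide 2, nor a positive c below ℓ.
  ∣multiple⇒≡0 : ¬ 2 ℕ∣.∣ ℓ → ∀ {c} → c < ℓ → ∀ n → ι (+ c) * alt n (const (ι (+ 2))) ≈[ 1 ] R.0# → c ≡ 0
  ∣multiple⇒≡0 odd {zero}  _   n _ = ≡.refl
  ∣multiple⇒≡0 odd {suc c} c<ℓ n p = ⊥-elim ([ ℕ∣.>⇒∤ c<ℓ , ℓ∤2 odd ]′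
    (euclidsLemma (suc c) 2 ℓ-prime (≡.subst (ℓ ℕ∣.∣_)
      (≡.trans (ℤₚ.abs-* (+ suc c) τ) (≡.cong (suc c ℕ.*_) (∣alt-const∣ (+ 2) n 1)))
      (ℤ∣.∣⇒∣ᵤ (≈[1]0⇒∣rep p 0)))))
    where τ = rep (alt n (const (ι (+ 2)))) 1

  -- The alternating sum is computed twice: it vanishes modulo ℓ by assumption, and loop by loop it
  -- is ±2c with c ≤ t < ℓ. Hence c = 0 and ℓ divides every voltage, against admissibility.
  some-coefficient≉0 : ¬ 2 ℕ∣.∣ ℓ → ∀ {t} → t < ℓ → (α : Fin t → ℤ-adic ℓ) → Admissible α →
    ∀ n → suc n ≡ ℓ → ¬ (∀ {k} → k ≤ n → characteristicSeries ℓ-prime t α k ≈[ 1 ] R.0#)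
  some-coefficient≉0 odd t<ℓ α admissible n n+1≡ℓ f≈0 =
    let c , c≤t , c≡0⇒α≈0 , sum≈ = indicator-sum (λ j → ≈[1]0? (α j)) (alt n (const (ι (+ 2))))
          (λ j → alt n (loopSeries (α j)))
          (λ j → alt-loop-nonunit {α j} n+1≡ℓ) (λ j → alt-loop-unit {α j} n+1≡ℓ)
        sum≈0 = ≈[]-trans (≈⇒≈[] (R.sym (alt-⨁ n (λ j → loopSeries (α j))))) (alt-zero[] n f≈0)
        c≡0 = ∣multiple⇒≡0 odd (ℕₚ.≤-<-trans c≤t t<ℓ) n (≈[]-trans (≈[]-sym sum≈) sum≈0)
    in admissible λ j → ≈[1]0⇒∣ (c≡0⇒α≈0 c≡0 j)

  -- Divisibility by ℓ is decidable and the search is confined to degrees below ℓ, so a negated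
  -- universal statement yields a witness constructively.
  least-coefficient≉0 : (f : Series) → ¬ (∀ {k} → k < ℓ → f k ≈[ 1 ] R.0#) →
    ∃[ d ] ¬ f d ≈[ 1 ] R.0# × (∀ {i} → i < d → f i ≈[ 1 ] R.0#)
  least-coefficient≉0 f f≉0
    with d , fd≉0 , below ← ¬∀⟶∃¬-smallest ℓ (λ k → f (toℕ k) ≈[ 1 ] R.0#) (λ k → ≈[1]0? (f (toℕ k)))
           (λ f≈0 → f≉0 λ k<ℓ → ≡.subst (λ k → f k ≈[ 1 ] R.0#) (toℕ-fromℕ< k<ℓ) (f≈0 (fromℕ< k<ℓ)))
    = toℕ d , fd≉0 , λ i<d → ≡.subst (λ k → f k ≈[ 1 ] R.0#)
        (≡.trans (toℕ-inject (fromℕ< i<d)) (toℕ-fromℕ< i<d)) (below (fromℕ< i<d))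

  μ≡0 : ∀ {f d} → ¬ f d ≈[ 1 ] R.0# → (w : WeierstrassFactorization f) →
        WeierstrassFactorization.μ w ≡ 0
  μ≡0 {f} {d} fd≉0 w with WeierstrassFactorization.μ w in eq
  ... | zero  = ≡.refl
  ... | suc _ = ⊥-elim (fd≉0 (μ>0⇒ℓ∣ w eq d))

  leading-inverse : ∀ {x} → ¬ x ≈[ 1 ] R.0# → ∃[ c ] c * x ≈[ 1 ] R.1#
  leading-inverse {x} x≉0 with c , h ← inverse-mod (rep x 1) (λ h → x≉0 (∣rep⇒≈[1]0 0 h)) =
    ι c , mod (≡.subst (ℤ∣._∣ (c ℤ.* rep x 1 ℤ.- + 1)) (≡.cong +_ (≡.sym (ℕₚ.*-identityʳ ℓ))) h)

open import Data.Nat.Divisibility using (_∣_)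

corollary4p3 : (ℓ : ℕ) (ℓ-prime : Prime ℓ) → ¬ (2 ∣ ℓ) →
    (t : ℕ) → 2 ≤ t →
    (α : Fin t → ℤ-adic ℓ) → Admissible α →
    t < ℓ →
    μ ℓ-prime [X t , α ]≡ 0
corollary4p3 ℓ ℓ-prime odd t _ α admissible t<ℓ =
  let f = characteristicSeries ℓ-prime t α
      ℓ≢0 = prime⇒nonZero ℓ-prime
      d , fd≉0 , below = least-coefficient≉0 ℓ-prime f λ f≈0 →
        -- The alternating sum runs through degree ℓ - 1, that is, over the first ℓ coefficients.
        some-coefficient≉0 ℓ-prime odd t<ℓ α admissible (ℕ.pred ℓ) (ℕₚ.suc-pred ℓ {{ℓ≢0}})
          (λ k≤ → f≈0 (ℕₚ.≤-trans (ℕ.s≤s k≤) (ℕₚ.≤-reflexive (ℕₚ.suc-pred ℓ {{ℓ≢0}}))))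
      c , c*fd≈1 = leading-inverse ℓ-prime fd≉0
  in Congruence.weierstrassPreparation ℓ {{ℓ≢0}} d f c below c*fd≈1 , μ≡0 ℓ-prime fd≉0
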